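{- For every $n\ge 1$ and every $f:\{0,1\}^n\to\{0,1\}$, $C(f)\le \mathrm{EC}(f)^2$.
   Context: Let $f:\{0,1\}^n\to\{0,1\}$ and $[n]=\{1,\dots,n\}$. Certificate complexity: an assignment is a map $A:[n]\to\{0,1,*\}$, identified with the subcube $\{x: \forall i,\ x_i=A(i)\text{ or }A(i)=*\}$; its size is $|A|=|\{i:A(i)\ne *\}|$. A $b$-certificate for $f$ is an assignment $A$ such that $x\in A\Rightarrow f(x)=b$. $C(f,x)$ is the size of the smallest $f(x)$-certificate consistent with $x$ (i.e. with $x\in A$), and $C(f)=\max_x C(f,x)$. The expectational certificate complexity $\mathrm{EC}(f)$ is the optimal value of the following program over families $\{w_x\}_{x\in\{0,1\}^n}$, $w_x\in\mathbb R^n$: minimize $\max_{x}\sum_{i=1}^n w_x(i)$ subject to $\sum_{i:x_i\ne y_i} w_x(i)w_y(i)\ge 1$ for all $x,y$ with $f(x)\ne f(y)$, and $0\le w_x(i)\le 1$ for all $x\in\{0,1\}^n$, $i\in[n]$. -}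

module Defs where

open import Data.Bool.Base using (Bool; true; false; if_then_else_)
import Data.Bool.Properties as Bool
open import Data.Empty using (⊥-elim)
open import Data.Fin.Base using (Fin; zero; suc; toℕ; fromℕ; fromℕ<)
open import Data.Fin.Properties using (toℕ-fromℕ; toℕ-fromℕ<) renaming (all? to allFin?)
import Data.Integer.Base as ℤ
import Data.Integer.Properties as ℤ
open import Data.List.Base using (List; []; _∷_; filter; cartesianProductWith; allFin)
import Data.List.Base as List
import Data.List.Extrema
open import Data.List.Extrema.Nat using (argmin; argmin-all; f[argmin]≤f[xs])
open import Data.List.Membership.Propositional using (_∈_; lose; find)
open import Data.List.Membership.Propositional.Properties
  using (∈-allFin; ∈-filter⁺; ∈-cartesianProductWith⁺)
import Data.List.Relation.Unary.All as All
open import Data.List.Relation.Unary.All.Properties using (all-filter)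
open import Data.List.Relation.Unary.Any using (Any; here; there)
import Data.List.Relation.Unary.Any as Any
open import Data.List.Relation.Unary.Any.Properties using (cartesianProductWith⁺; map⁺)
open import Data.Maybe.Base using (Maybe; just; nothing)
open import Data.Maybe.Properties using (just-injective) renaming (≡-dec to ≡-dec-Maybe)
open import Data.Nat.Base as ℕ using (ℕ; zero; suc; z≤n; s≤s)
open import Data.Nat.Coprimality using (1-coprimeTo) renaming (sym to coprime-sym)
import Data.Nat.Properties as ℕ
open import Data.Product using (∃; _×_; _,_; proj₁; proj₂)
open import Data.Rational.Base
  using (ℚ; mkℚ; 0ℚ; 1ℚ; _+_; _-_; -_; _*_; 1/_; _⊔_; _⊓_; ∣_∣; _≤_; _<_; *≤*; *<*;
         NonNegative; Positive; positive; nonNegative; toℚᵘ)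
open import Data.Rational.Properties
open import Data.Rational.Solver using (module +-*-Solver)
import Data.Rational.Unnormalised.Base as ℚᵘ
import Data.Rational.Unnormalised.Properties as ℚᵘ
open import Data.Sum.Base using (_⊎_; inj₁; inj₂)
open import Data.Unit.Base using (tt)
import Data.Vec.Functional as Vector
open import Data.Vec.Base using (Vec; []; _∷_; lookup; map; count)
open import Data.Vec.Properties using (lookup-map)
open import Function.Base using (_∘_)
open import Relation.Binary.Bundles using (DecTotalOrder)
open import Relation.Binary.PropositionalEquality
  using (_≡_; _≢_; refl; sym; trans; cong; cong₂; subst)
open import Relation.Nullary.Decidable
  using (Dec; yes; no; does; map′; ¬?; _×-dec_; _⊎-dec_; _→-dec_)
open import Relation.Nullary.Negation using (¬_; contradiction)

private
  variable
    p q r s ε : ℚ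

open +-*-Solver using (solve; _:+_; _:*_; _:-_; :-_; _:=_)

≤+⇒-≤ : p ≤ q + ε → p - q ≤ ε
≤+⇒-≤ {p} {q} {ε} p≤q+ε = begin
  p - q      ≤⟨ +-monoˡ-≤ (- q) p≤q+ε ⟩
  q + ε - q  ≡⟨ solve 2 (λ q ε → q :+ ε :- q := ε) refl q ε ⟩
  ε          ∎
  where open ≤-Reasoning

-≤⇒≤+ : p - q ≤ ε → p ≤ q + ε
-≤⇒≤+ {p} {q} {ε} p-q≤ε = begin
  p            ≡⟨ solve 2 (λ p q → p := q :+ (p :- q)) refl p q ⟩
  q + (p - q)  ≤⟨ +-monoʳ-≤ q p-q≤ε ⟩
  q + ε        ∎
  where open ≤-Reasoning

p≤∣p∣ : ∀ p → p ≤ ∣ p ∣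
p≤∣p∣ p with ≤-total 0ℚ p
... | inj₁ 0≤p = ≤-reflexive (sym (0≤p⇒∣p∣≡p 0≤p))
... | inj₂ p≤0 = ≤-trans p≤0 (0≤∣p∣ p)

∣p∣≤ : p ≤ q → - p ≤ q → ∣ p ∣ ≤ q
∣p∣≤ {p} p≤q -p≤q with ∣p∣≡p∨∣p∣≡-p p
... | inj₁ eq = ≤-trans (≤-reflexive eq) p≤q
... | inj₂ eq = ≤-trans (≤-reflexive eq) -p≤q

∣-∣≤⇒≤+ : ∣ p - q ∣ ≤ ε → p ≤ q + ε
∣-∣≤⇒≤+ {p} {q} h = -≤⇒≤+ (≤-trans (p≤∣p∣ (p - q)) h)

≤+⇒∣-∣≤ : p ≤ q + ε → q ≤ p + ε → ∣ p - q ∣ ≤ ε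
≤+⇒∣-∣≤ {p} {q} h₁ h₂ = ∣p∣≤ (≤+⇒-≤ h₁)
  (≤-trans (≤-reflexive (solve 2 (λ p q → :- (p :- q) := q :- p) refl p q)) (≤+⇒-≤ h₂))

≤-steps : 0ℚ ≤ ε → p ≤ p + ε
≤-steps {ε} {p} 0≤ε = ≤-trans (≤-reflexive (sym (+-identityʳ p))) (+-monoʳ-≤ p 0≤ε)

*-mono-≤ : 0ℚ ≤ p → p ≤ q → 0ℚ ≤ r → r ≤ s → p * r ≤ q * s
*-mono-≤ {p} {q} {r} {s} 0≤p p≤q 0≤r r≤s = ≤-trans
  (*-monoʳ-≤-nonNeg r {{nonNegative 0≤r}} p≤q)
  (*-monoˡ-≤-nonNeg q {{nonNegative (≤-trans 0≤p p≤q)}} r≤s)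

*-nonneg : 0ℚ ≤ p → 0ℚ ≤ q → 0ℚ ≤ p * q
*-nonneg {p} {q} 0≤p 0≤q = *-mono-≤ {0ℚ} {p} {0ℚ} {q} ≤-refl 0≤p ≤-refl 0≤q

0<1 : 0ℚ < 1ℚ
0<1 = positive⁻¹ 1ℚ

0≤1 : 0ℚ ≤ 1ℚ
0≤1 = <⇒≤ 0<1

divide : 0ℚ < q → 0ℚ < ε → ∃ λ δ → 0ℚ < δ × δ * q ≡ ε
divide {q} {ε} 0<q 0<ε =
  ε * 1/ q ,
  ≤-<-trans (≤-reflexive (sym (*-zeroˡ (1/ q))))
            (*-monoˡ-<-pos (1/ q) {{1/pos⇒pos q}} 0<ε) ,
  trans (*-assoc ε (1/ q) q) (trans (cong (ε *_) (*-inverseˡ q)) (*-identityʳ ε))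
  where instance
    _ = positive 0<q
    _ = pos⇒nonZero q

halve : 0ℚ < ε → ∃ λ δ → 0ℚ < δ × δ + δ ≡ ε
halve 0<ε with divide {1ℚ + 1ℚ} (+-mono-< 0<1 0<1) 0<ε
... | δ , 0<δ , eq = δ , 0<δ , trans (sym lemma) eq
  where
  lemma : δ * (1ℚ + 1ℚ) ≡ δ + δ
  lemma = trans (*-distribˡ-+ δ 1ℚ 1ℚ) (cong₂ _+_ (*-identityʳ δ) (*-identityʳ δ))

≤-closed : (∀ ε → 0ℚ < ε → p ≤ q + ε) → p ≤ q
≤-closed {p} {q} h = ≮⇒≥ λ q<p →
  let 0<p-q = <-respˡ-≡ (+-inverseʳ q) (+-monoˡ-< (- q) q<p)
      δ , 0<δ , eq = halve 0<p-q
  in <-irrefl refl (begin-strict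
    p            ≤⟨ h δ 0<δ ⟩
    q + δ        <⟨ +-monoʳ-< q (<-respˡ-≡ (+-identityʳ δ) (+-monoʳ-< δ 0<δ)) ⟩
    q + (δ + δ)  ≡⟨ cong (q +_) eq ⟩
    q + (p - q)  ≡⟨ solve 2 (λ p q → q :+ (p :- q) := p) refl p q ⟩
    p            ∎)
  where open ≤-Reasoning

-- Real numbers, as Cauchy sequences of rationals.  Real equality is
-- x ≤ᴿ y × y ≤ᴿ x, not _≡_.

Eventually : (ℕ → Set) → Set
Eventually P = ∃ λ N → ∀ n → N ℕ.≤ n → P n

Cauchy : (ℕ → ℚ) → Set
Cauchy s = ∀ ε → 0ℚ < ε → ∃ λ N → ∀ m n → N ℕ.≤ m → N ℕ.≤ n → ∣ s m - s n ∣ ≤ ε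

record ℝ : Set where
  constructor mkℝ
  field
    seq    : ℕ → ℚ
    cauchy : Cauchy seq

open ℝ public

infix 4 _≤ᴿ_

record _≤ᴿ_ (x y : ℝ) : Set where
  constructor mk≤ᴿ
  field
    within : ∀ ε → 0ℚ < ε → Eventually λ n → seq x n ≤ seq y n + ε

open _≤ᴿ_ public

always : {P : ℕ → Set} → (∀ n → P n) → Eventually P
always h = 0 , λ n _ → h n

ev-const : {P : Set} → Eventually (λ _ → P) → P
ev-const (N , h) = h N ℕ.≤-refl

ev-map : {P Q : ℕ → Set} → (∀ {n} → P n → Q n) → Eventually P → Eventually Q
ev-map f (N , h) = N , λ n N≤n → f (h n N≤n)

ev-zip : {P Q R : ℕ → Set} → (∀ {n} → P n → Q n → R n) →
         Eventually P → Eventually Q → Eventually R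
ev-zip f (M , g) (N , h) = M ℕ.⊔ N , λ n le →
  f (g n (ℕ.≤-trans (ℕ.m≤m⊔n M N) le)) (h n (ℕ.≤-trans (ℕ.m≤n⊔m M N) le))

cauchy-≤ : ∀ {s : ℕ → ℚ} → Cauchy s → ∀ ε → 0ℚ < ε →
           ∃ λ N → ∀ m n → N ℕ.≤ m → N ℕ.≤ n → s m ≤ s n + ε
cauchy-≤ {s} c ε 0<ε = let N , h = c ε 0<ε in N , λ m n N≤m N≤n → ∣-∣≤⇒≤+ {s m} {s n} {ε} (h m n N≤m N≤n)

≤-cauchy : ∀ {s : ℕ → ℚ} →
           (∀ ε → 0ℚ < ε → ∃ λ N → ∀ m n → N ℕ.≤ m → N ℕ.≤ n → s m ≤ s n + ε) →
           Cauchy s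
≤-cauchy {s} c ε 0<ε = let N , h = c ε 0<ε in N , λ m n N≤m N≤n → ≤+⇒∣-∣≤ {s m} {s n} {ε} (h m n N≤m N≤n) (h n m N≤n N≤m)

cauchy₂ : ∀ {s t u : ℕ → ℚ} → Cauchy s → Cauchy t → ∀ δ ε → 0ℚ < δ →
          (∀ m n → s m ≤ s n + δ → t m ≤ t n + δ → u m ≤ u n + ε) →
          ∃ λ N → ∀ m n → N ℕ.≤ m → N ℕ.≤ n → u m ≤ u n + ε
cauchy₂ {s} {t} {u} c d δ ε 0<δ f =
  let M , g = cauchy-≤ {s} c δ 0<δ
      N , h = cauchy-≤ {t} d δ 0<δ
  in M ℕ.⊔ N , λ m n le le′ → f m n
       (g m n (ℕ.≤-trans (ℕ.m≤m⊔n M N) le) (ℕ.≤-trans (ℕ.m≤m⊔n M N) le′))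
       (h m n (ℕ.≤-trans (ℕ.m≤n⊔m M N) le) (ℕ.≤-trans (ℕ.m≤n⊔m M N) le′))

abstract
  const-cauchy : ∀ q → Cauchy (λ _ → q)
  const-cauchy q = ≤-cauchy {λ _ → q} λ ε 0<ε → 0 , λ _ _ _ _ → ≤-steps {ε} {q} (<⇒≤ 0<ε)

fromℚ : ℚ → ℝ
fromℚ q = mkℝ (λ _ → q) (const-cauchy q)

fromℕℚ : ℕ → ℚ
fromℕℚ n = mkℚ (ℤ.+ n) 0 (coprime-sym (1-coprimeTo n))

fromℕᴿ : ℕ → ℝ
fromℕᴿ n = fromℚ (fromℕℚ n)

0ᴿ 1ᴿ : ℝ
0ᴿ = fromℚ 0ℚ
1ᴿ = fromℚ 1ℚ

infixl 6 _+ᴿ_ _⊔ᴿ_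
infixl 7 _*ᴿ_

+-approx : ∀ {a b c d δ ε} → δ + δ ≡ ε → a ≤ b + δ → c ≤ d + δ → a + c ≤ b + d + ε
+-approx {a} {b} {c} {d} {δ} refl h₁ h₂ = ≤-trans (+-mono-≤ {a} {b + δ} {c} {d + δ} h₁ h₂) (≤-reflexive
  (solve 3 (λ b d δ → b :+ δ :+ (d :+ δ) := b :+ d :+ (δ :+ δ)) refl b d δ))

⊔-approx : ∀ {a b c d ε} → a ≤ b + ε → c ≤ d + ε → a ⊔ c ≤ b ⊔ d + ε
⊔-approx {a} {b} {c} {d} {ε} h₁ h₂ = ⊔-lub
  (≤-trans h₁ (+-monoˡ-≤ ε (p≤p⊔q b d)))
  (≤-trans h₂ (+-monoˡ-≤ ε (p≤q⊔p b d)))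

abstract
  +-cauchy : ∀ {s t : ℕ → ℚ} → Cauchy s → Cauchy t → Cauchy (λ n → s n + t n)
  +-cauchy {s} {t} c d = ≤-cauchy {λ n → s n + t n} λ ε 0<ε →
    let δ , 0<δ , δ+δ≡ε = halve 0<ε
    in cauchy₂ {s} {t} {λ n → s n + t n} c d δ ε 0<δ λ m n →
         +-approx {s m} {s n} {t m} {t n} {δ} {ε} δ+δ≡ε

abstract
  ⊔-cauchy : ∀ {s t : ℕ → ℚ} → Cauchy s → Cauchy t → Cauchy (λ n → s n ⊔ t n)
  ⊔-cauchy {s} {t} c d = ≤-cauchy {λ n → s n ⊔ t n} λ ε 0<ε →
    cauchy₂ {s} {t} {λ n → s n ⊔ t n} c d ε ε 0<ε λ m n →
      ⊔-approx {s m} {s n} {t m} {t n} {ε}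

_+ᴿ_ : ℝ → ℝ → ℝ
x +ᴿ y = mkℝ (λ n → seq x n + seq y n) (+-cauchy {seq x} {seq y} (cauchy x) (cauchy y))

_⊔ᴿ_ : ℝ → ℝ → ℝ
x ⊔ᴿ y = mkℝ (λ n → seq x n ⊔ seq y n) (⊔-cauchy {seq x} {seq y} (cauchy x) (cauchy y))

bounded : ∀ {s : ℕ → ℚ} → Cauchy s → ∃ λ B → 0ℚ < B × Eventually λ n → ∣ s n ∣ ≤ B
bounded {s} c = ∣ s N ∣ + 1ℚ , +-mono-≤-< (0≤∣p∣ (s N)) 0<1 , N , λ n N≤n → begin
  ∣ s n ∣                  ≡⟨ cong ∣_∣ (solve 2 (λ a b → a := b :+ (a :- b)) refl (s n) (s N)) ⟩
  ∣ s N + (s n - s N) ∣    ≤⟨ ∣p+q∣≤∣p∣+∣q∣ (s N) (s n - s N) ⟩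
  ∣ s N ∣ + ∣ s n - s N ∣  ≤⟨ +-monoʳ-≤ ∣ s N ∣ (proj₂ (c 1ℚ 0<1) n N N≤n ℕ.≤-refl) ⟩
  ∣ s N ∣ + 1ℚ             ∎
  where
  open ≤-Reasoning
  N = proj₁ (c 1ℚ 0<1)

∣*-*∣≤ : ∀ {a b c d A B δ} → ∣ a ∣ ≤ A → ∣ d ∣ ≤ B → ∣ a - c ∣ ≤ δ → ∣ b - d ∣ ≤ δ →
         ∣ a * b - c * d ∣ ≤ δ * (A + B)
∣*-*∣≤ {a} {b} {c} {d} {A} {B} {δ} a≤ d≤ ac bd = begin
  ∣ a * b - c * d ∣
    ≡⟨ cong ∣_∣ (solve 4 (λ a b c d → a :* b :- c :* d := a :* (b :- d) :+ (a :- c) :* d)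
                         refl a b c d) ⟩
  ∣ a * (b - d) + (a - c) * d ∣
    ≤⟨ ∣p+q∣≤∣p∣+∣q∣ (a * (b - d)) ((a - c) * d) ⟩
  ∣ a * (b - d) ∣ + ∣ (a - c) * d ∣
    ≡⟨ cong₂ _+_ (∣p*q∣≡∣p∣*∣q∣ a (b - d)) (∣p*q∣≡∣p∣*∣q∣ (a - c) d) ⟩
  ∣ a ∣ * ∣ b - d ∣ + ∣ a - c ∣ * ∣ d ∣
    ≤⟨ +-mono-≤ (*-mono-≤ {∣ a ∣} {A} (0≤∣p∣ a) a≤ (0≤∣p∣ (b - d)) bd)
                (*-mono-≤ {∣ a - c ∣} {δ} (0≤∣p∣ (a - c)) ac (0≤∣p∣ d) d≤) ⟩
  A * δ + δ * B
    ≡⟨ solve 3 (λ A B δ → A :* δ :+ δ :* B := δ :* (A :+ B)) refl A B δ ⟩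
  δ * (A + B) ∎
  where open ≤-Reasoning

abstract
  *-cauchy : ∀ {s t : ℕ → ℚ} → Cauchy s → Cauchy t → Cauchy (λ n → s n * t n)
  *-cauchy {s} {t} c d ε 0<ε =
    let A , 0<A , M , hA = bounded {s} c
        B , 0<B , N , hB = bounded {t} d
        δ , 0<δ , eq = divide (+-mono-< 0<A 0<B) 0<ε
        M′ , g = c δ 0<δ
        N′ , h = d δ 0<δ
        K = (M ℕ.⊔ N) ℕ.⊔ (M′ ℕ.⊔ N′)
        M≤K  = ℕ.≤-trans (ℕ.m≤m⊔n M N) (ℕ.m≤m⊔n (M ℕ.⊔ N) (M′ ℕ.⊔ N′))
        N≤K  = ℕ.≤-trans (ℕ.m≤n⊔m M N) (ℕ.m≤m⊔n (M ℕ.⊔ N) (M′ ℕ.⊔ N′))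
        M′≤K = ℕ.≤-trans (ℕ.m≤m⊔n M′ N′) (ℕ.m≤n⊔m (M ℕ.⊔ N) (M′ ℕ.⊔ N′))
        N′≤K = ℕ.≤-trans (ℕ.m≤n⊔m M′ N′) (ℕ.m≤n⊔m (M ℕ.⊔ N) (M′ ℕ.⊔ N′))
    in K , λ m n K≤m K≤n → subst (∣ s m * t m - s n * t n ∣ ≤_) eq
         (∣*-*∣≤ {s m} {t m} {s n} {t n}
           (hA m (ℕ.≤-trans M≤K K≤m)) (hB n (ℕ.≤-trans N≤K K≤n))
           (g m n (ℕ.≤-trans M′≤K K≤m) (ℕ.≤-trans M′≤K K≤n))
           (h m n (ℕ.≤-trans N′≤K K≤m) (ℕ.≤-trans N′≤K K≤n)))

_*ᴿ_ : ℝ → ℝ → ℝ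
x *ᴿ y = mkℝ (λ n → seq x n * seq y n) (*-cauchy {seq x} {seq y} (cauchy x) (cauchy y))

∑ : ∀ {n} → (Fin n → ℝ) → ℝ
∑ = Vector.foldr _+ᴿ_ 0ᴿ

Input : ℕ → Set
Input n = Vec Bool n

BoolFun : ℕ → Set
BoolFun n = Input n → Bool

-- The maximum over {0,1}ⁿ, where _∙_ is a binary maximum.

maxInput : ∀ {A : Set} → (A → A → A) → ∀ {n} → (Input n → A) → A
maxInput _∙_ {zero}  g = g []
maxInput _∙_ {suc n} g =
  maxInput _∙_ (λ x → g (false ∷ x)) ∙ maxInput _∙_ (λ x → g (true ∷ x))

allInput? : ∀ {n} {P : Input n → Set} → (∀ x → Dec (P x)) → Dec (∀ x → P x)
allInput? {zero}  P? = map′ (λ { p [] → p }) (λ h → h []) (P? [])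
allInput? {suc n} P? = map′
  (λ { (h , k) (false ∷ x) → h x ; (h , k) (true ∷ x) → k x })
  (λ h → (λ x → h (false ∷ x)) , (λ x → h (true ∷ x)))
  (allInput? (λ x → P? (false ∷ x)) ×-dec allInput? (λ x → P? (true ∷ x)))

-- nothing plays the role of *.

Assignment : ℕ → Set
Assignment n = Vec (Maybe Bool) n

_≟ᴬ_ : (a b : Maybe Bool) → Dec (a ≡ b)
_≟ᴬ_ = ≡-dec-Maybe Bool._≟_

size : ∀ {n} → Assignment n → ℕ
size = count (λ a → ¬? (a ≟ᴬ nothing))

infix 4 _∈ᴬ_

_∈ᴬ_ : ∀ {n} → Input n → Assignment n → Set
x ∈ᴬ A = ∀ i → lookup A i ≡ just (lookup x i) ⊎ lookup A i ≡ nothing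

IsCertificate : ∀ {n} → BoolFun n → Bool → Assignment n → Set
IsCertificate f b A = ∀ x → x ∈ᴬ A → f x ≡ b

_∈ᴬ?_ : ∀ {n} (x : Input n) (A : Assignment n) → Dec (x ∈ᴬ A)
x ∈ᴬ? A = allFin? λ i → (lookup A i ≟ᴬ just (lookup x i)) ⊎-dec (lookup A i ≟ᴬ nothing)

isCertificate? : ∀ {n} (f : BoolFun n) b (A : Assignment n) → Dec (IsCertificate f b A)
isCertificate? f b A = allInput? λ x → (x ∈ᴬ? A) →-dec (f x Bool.≟ b)

allAssignments : ∀ n → List (Assignment n)
allAssignments zero    = [] ∷ []
allAssignments (suc n) =
  cartesianProductWith _∷_ (nothing ∷ just false ∷ just true ∷ []) (allAssignments n)

Certifies : ∀ {n} → BoolFun n → Input n → Assignment n → Set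
Certifies f x A = x ∈ᴬ A × IsCertificate f (f x) A

certifies? : ∀ {n} (f : BoolFun n) (x : Input n) (A : Assignment n) → Dec (Certifies f x A)
certifies? f x A = (x ∈ᴬ? A) ×-dec isCertificate? f (f x) A

-- The search starts from the assignment fixing every coordinate to its
-- value in x, which is itself a certificate; smallestCertificate-certifies
-- and smallestCertificate-minimal characterise the result.

smallestCertificate : ∀ {n} → BoolFun n → Input n → Assignment n
smallestCertificate {n} f x =
  argmin size (map just x) (filter (certifies? f x) (allAssignments n))

C[_,_] : ∀ {n} → BoolFun n → Input n → ℕ
C[ f , x ] = size (smallestCertificate f x)

C : ∀ {n} → BoolFun n → ℕ
C f = maxInput ℕ._⊔_ (λ x → C[ f , x ])

full-unique : ∀ {n} (x y : Input n) → y ∈ᴬ map just x → y ≡ x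
full-unique []      []      h = refl
full-unique (a ∷ x) (b ∷ y) h with h zero
... | inj₁ eq = cong₂ _∷_ (sym (just-injective eq)) (full-unique x y (λ i → h (suc i)))

full-certifies : ∀ {n} (f : BoolFun n) (x : Input n) → Certifies f x (map just x)
full-certifies f x =
  (λ i → inj₁ (lookup-map i just x)) , (λ y y∈ → cong f (full-unique x y y∈))

∈-allAssignments : ∀ {n} (A : Assignment n) → A ∈ allAssignments n
∈-allAssignments []      = here refl
∈-allAssignments (a ∷ A) = ∈-cartesianProductWith⁺ _∷_ (mem a) (∈-allAssignments A)
  where
  mem : ∀ a → a ∈ nothing ∷ just false ∷ just true ∷ []
  mem nothing      = here refl
  mem (just false) = there (here refl)
  mem (just true)  = there (there (here refl))

smallestCertificate-certifies : ∀ {n} (f : BoolFun n) (x : Input n) →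
                                Certifies f x (smallestCertificate f x)
smallestCertificate-certifies {n} f x = argmin-all size {P = Certifies f x}
  (full-certifies f x) (all-filter (certifies? f x) (allAssignments n))

smallestCertificate-minimal : ∀ {n} (f : BoolFun n) (x : Input n) (A : Assignment n) →
                              Certifies f x A → C[ f , x ] ℕ.≤ size A
smallestCertificate-minimal {n} f x A cert = All.lookup
  (f[argmin]≤f[xs] {f = size} (map just x) (filter (certifies? f x) (allAssignments n)))
  (∈-filter⁺ (certifies? f x) (∈-allAssignments A) cert)

Weights : ℕ → Set
Weights n = Input n → Fin n → ℝ

-- The i-th summand of the sum of w_x(i) w_y(i) over { i : x_i ≠ y_i }.

sepTerm : ∀ {n} → Weights n → Input n → Input n → Fin n → ℝ
sepTerm w x y i =
  if does (lookup x i Bool.≟ lookup y i) then 0ᴿ else w x i *ᴿ w y i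

record Feasible {n} (f : BoolFun n) (w : Weights n) : Set where
  field
    separates : ∀ x y → f x ≢ f y → 1ᴿ ≤ᴿ ∑ (sepTerm w x y)
    nonneg    : ∀ x i → 0ᴿ ≤ᴿ w x i
    atMostOne : ∀ x i → w x i ≤ᴿ 1ᴿ

open Feasible public

objective : ∀ {n} → Weights n → ℝ
objective w = maxInput _⊔ᴿ_ (λ x → ∑ (w x))

-- The infimum of the objective over the feasible weights.  It is attained
-- classically, by compactness; constructively one can only ask for
-- feasible weights within every ε of it.

record IsOptimalValue {n} (f : BoolFun n) (v : ℝ) : Set where
  field
    lowerBound  : ∀ w → Feasible f w → v ≤ᴿ objective w
    approached  : ∀ ε → 0ℚ < ε → ∃ λ w → Feasible f w × objective w ≤ᴿ v +ᴿ fromℚ ε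

open IsOptimalValue public

-- Existence of the optimal value: it is the limit, as k grows, of the
-- minimum over the feasible weights that are multiples of 1/(k+1).

≤ᴿ-trans : ∀ {x y z} → x ≤ᴿ y → y ≤ᴿ z → x ≤ᴿ z
≤ᴿ-trans {x} {y} {z} h k .within ε 0<ε =
  let δ , 0<δ , δ+δ≡ε = halve 0<ε
  in ev-zip (λ {n} a b → ≤-trans a (≤-trans (+-monoˡ-≤ δ b) (≤-reflexive
       (trans (+-assoc (seq z n) δ δ) (cong (seq z n +_) δ+δ≡ε)))))
     (within h δ 0<δ) (within k δ 0<δ)

pointwise-≤ : ∀ {x y} → (∀ n → seq x n ≤ seq y n) → x ≤ᴿ y
pointwise-≤ {x} {y} h .within ε 0<ε =
  always λ n → ≤-trans (h n) (≤-steps {ε} {seq y n} (<⇒≤ 0<ε))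

≤ᴿ-refl : ∀ {x} → x ≤ᴿ x
≤ᴿ-refl = pointwise-≤ λ n → ≤-refl

+ᴿ-mono : ∀ {x x′ y y′} → x ≤ᴿ x′ → y ≤ᴿ y′ → x +ᴿ y ≤ᴿ x′ +ᴿ y′
+ᴿ-mono {x} {x′} {y} {y′} h k .within ε 0<ε =
  let δ , 0<δ , δ+δ≡ε = halve 0<ε
  in ev-zip (λ {n} → +-approx {seq x n} {seq x′ n} {seq y n} {seq y′ n} δ+δ≡ε)
     (within h δ 0<δ) (within k δ 0<δ)

∑-mono : ∀ {n} {s t : Fin n → ℝ} → (∀ i → s i ≤ᴿ t i) → ∑ s ≤ᴿ ∑ t
∑-mono {zero}  h = ≤ᴿ-refl
∑-mono {suc n} h = +ᴿ-mono (h zero) (∑-mono (h ∘ suc))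

⊓-pos : 0ℚ < p → 0ℚ < q → 0ℚ < p ⊓ q
⊓-pos {p} {q} 0<p 0<q with ⊓-sel p q
... | inj₁ eq = <-respʳ-≡ (sym eq) 0<p
... | inj₂ eq = <-respʳ-≡ (sym eq) 0<q

*-square-approx : ∀ {a b g h δ ε} → 0ℚ ≤ g → g ≤ 1ℚ → 0ℚ ≤ h → h ≤ 1ℚ →
                  0ℚ ≤ δ → δ ≤ 1ℚ → δ * (1ℚ + 1ℚ + 1ℚ) ≤ ε →
                  0ℚ ≤ a + δ → a ≤ g + δ → 0ℚ ≤ b + δ → b ≤ h + δ → a * b ≤ g * h + ε
*-square-approx {a} {b} {g} {h} {δ} {ε} 0≤g g≤1 0≤h h≤1 0≤δ δ≤1 3δ≤ε 0≤a a≤ 0≤b b≤ = begin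
  a * b                     ≤⟨ p≤∣p∣ (a * b) ⟩
  ∣ a * b ∣                 ≡⟨ ∣p*q∣≡∣p∣*∣q∣ a b ⟩
  ∣ a ∣ * ∣ b ∣             ≤⟨ *-mono-≤ {∣ a ∣} {g + δ} (0≤∣p∣ a) (∣p∣≤ {a} a≤ (neg a g 0≤g 0≤a))
                                        (0≤∣p∣ b) (∣p∣≤ {b} b≤ (neg b h 0≤h 0≤b)) ⟩
  (g + δ) * (h + δ)         ≡⟨ solve 3 (λ g h δ → (g :+ δ) :* (h :+ δ) :=
                                          g :* h :+ δ :* (g :+ h :+ δ)) refl g h δ ⟩
  g * h + δ * (g + h + δ)   ≤⟨ +-monoʳ-≤ (g * h) (*-monoˡ-≤-nonNeg δ {{nonNegative 0≤δ}}
                                 (+-mono-≤ {g + h} {1ℚ + 1ℚ} {δ} {1ℚ}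
                                   (+-mono-≤ {g} {1ℚ} {h} {1ℚ} g≤1 h≤1) δ≤1)) ⟩
  g * h + δ * (1ℚ + 1ℚ + 1ℚ) ≤⟨ +-monoʳ-≤ (g * h) 3δ≤ε ⟩
  g * h + ε                 ∎
  where
  open ≤-Reasoning
  neg : ∀ c u → 0ℚ ≤ u → 0ℚ ≤ c + δ → - c ≤ u + δ
  neg c u 0≤u 0≤c+δ = begin
    - c            ≡⟨ +-identityˡ (- c) ⟨
    0ℚ - c         ≤⟨ +-monoˡ-≤ (- c) 0≤c+δ ⟩
    c + δ - c      ≡⟨ solve 2 (λ c δ → c :+ δ :- c := δ) refl c δ ⟩
    δ              ≡⟨ +-identityˡ δ ⟨
    0ℚ + δ         ≤⟨ +-monoˡ-≤ δ 0≤u ⟩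
    u + δ          ∎

*ᴿ-mono-fromℚ : ∀ {x y g h} → 0ᴿ ≤ᴿ x → 0ᴿ ≤ᴿ y → x ≤ᴿ fromℚ g → y ≤ᴿ fromℚ h →
                0ℚ ≤ g → g ≤ 1ℚ → 0ℚ ≤ h → h ≤ 1ℚ → x *ᴿ y ≤ᴿ fromℚ g *ᴿ fromℚ h
*ᴿ-mono-fromℚ {x} {y} {g} {h} 0≤x 0≤y x≤g y≤h 0≤g g≤1 0≤h h≤1 .within ε 0<ε =
  let δ′ , 0<δ′ , eq = divide {1ℚ + 1ℚ + 1ℚ} (positive⁻¹ (1ℚ + 1ℚ + 1ℚ)) 0<ε
      δ = δ′ ⊓ 1ℚ
      0<δ = ⊓-pos 0<δ′ 0<1
      3δ≤ε = ≤-trans (*-monoʳ-≤-nonNeg (1ℚ + 1ℚ + 1ℚ) (p⊓q≤p δ′ 1ℚ)) (≤-reflexive eq)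
  in ev-zip (λ {n} (a , b) (c , d) →
         *-square-approx {seq x n} {seq y n} {g} {h} {δ} {ε}
           0≤g g≤1 0≤h h≤1 (<⇒≤ 0<δ) (p⊓q≤q δ′ 1ℚ) 3δ≤ε a b c d)
       (ev-zip _,_ (within 0≤x δ 0<δ) (within x≤g δ 0<δ))
       (ev-zip _,_ (within 0≤y δ 0<δ) (within y≤h δ 0<δ))

Constant : ℝ → Set
Constant x = ∀ n → seq x n ≡ seq x 0

+-constant : ∀ {x y} → Constant x → Constant y → Constant (x +ᴿ y)
+-constant c d n = cong₂ _+_ (c n) (d n)

∑-constant : ∀ {n} {t : Fin n → ℝ} → (∀ i → Constant (t i)) → Constant (∑ t)
∑-constant {zero}  c n = refl
∑-constant {suc _} {t} c = +-constant {t zero} {∑ (t ∘ suc)} (c zero) (∑-constant {t = t ∘ suc} (c ∘ suc))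

max-constant : ∀ {n} {t : Input n → ℝ} → (∀ x → Constant (t x)) → Constant (maxInput _⊔ᴿ_ t)
max-constant {zero}  c   = c []
max-constant {suc n} c m = cong₂ _⊔_ (max-constant (λ x → c (false ∷ x)) m)
                                     (max-constant (λ x → c (true ∷ x)) m)

sepTerm-constant : ∀ {n} (w : Weights n) → (∀ x i → Constant (w x i)) →
                   ∀ x y i → Constant (sepTerm w x y i)
sepTerm-constant w c x y i n with does (lookup x i Bool.≟ lookup y i)
... | true  = refl
... | false = cong₂ _*_ (c x i n) (c y i n)

constant-≤? : ∀ {x} → Constant x → Dec (1ᴿ ≤ᴿ x)
constant-≤? {x} c = map′
  (λ h → pointwise-≤ λ n → ≤-trans h (≤-reflexive (sym (c n))))
  (λ h → ≤-closed λ ε 0<ε → ev-const (ev-map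
     (λ {n} → subst (λ a → 1ℚ ≤ a + ε) (c n)) (within h ε 0<ε)))
  (1ℚ ≤? seq x 0)

fromℕℚ-suc : ∀ n → fromℕℚ (suc n) ≡ 1ℚ + fromℕℚ n
fromℕℚ-suc n = toℚᵘ-injective (ℚᵘ.≃-trans
  (ℚᵘ.*≡* (trans (ℤ.*-identityʳ (ℤ.+ suc n)) (sym (trans (ℤ.*-identityʳ _)
    (cong (λ a → ℤ.+ 1 ℤ.+ a) (ℤ.*-identityʳ (ℤ.+ n)))))))
  (ℚᵘ.≃-sym (toℚᵘ-homo-+ 1ℚ (fromℕℚ n))))

step : ℕ → ℚ
step k = 1/ fromℕℚ (suc k)

0≤step : ∀ k → 0ℚ ≤ step k
0≤step k = nonNegative⁻¹ (step k)

multiple : ℕ → ℕ → ℚ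
multiple k j = fromℕℚ j * step k

multiple-0 : ∀ k → multiple k 0 ≡ 0ℚ
multiple-0 k = *-zeroˡ (step k)

multiple-suc : ∀ k j → multiple k (suc j) ≡ step k + multiple k j
multiple-suc k j = trans (cong (_* step k) (fromℕℚ-suc j))
  (trans (*-distribʳ-+ (step k) 1ℚ (fromℕℚ j))
         (cong (_+ fromℕℚ j * step k) (*-identityˡ (step k))))

multiple-1 : ∀ k → multiple k (suc k) ≡ 1ℚ
multiple-1 k = *-inverseʳ (fromℕℚ (suc k))

0≤multiple : ∀ k j → 0ℚ ≤ multiple k j
0≤multiple k j = *-nonneg {fromℕℚ j} {step k} (nonNegative⁻¹ (fromℕℚ j)) (0≤step k)

Index : ℕ → Set
Index k = Fin (suc (suc k))

grid : ∀ k → Index k → ℚ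
grid k j = multiple k (toℕ j) ⊓ 1ℚ

0≤grid : ∀ k j → 0ℚ ≤ grid k j
0≤grid k j = ⊓-glb (0≤multiple k (toℕ j)) 0≤1

grid≤1 : ∀ k j → grid k j ≤ 1ℚ
grid≤1 k j = p⊓q≤q (multiple k (toℕ j)) 1ℚ

one : ∀ k → Index k
one k = fromℕ (suc k)

grid-one : ∀ k → grid k (one k) ≡ 1ℚ
grid-one k = trans
  (cong (_⊓ 1ℚ) (trans (cong (multiple k) (toℕ-fromℕ (suc k))) (multiple-1 k)))
  (⊓-idem 1ℚ)

step-small : 0ℚ < ε → ∃ λ N → ∀ k → N ℕ.≤ k → step k ≤ ε
step-small {ε@(mkℚ (ℤ.+ suc a) d _)} 0<ε = d , λ k d≤k →
  *-cancelˡ-≤-pos (fromℕℚ (suc k)) (≤-trans (≤-reflexive (*-inverseʳ (fromℕℚ (suc k))))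
    (toℚᵘ-cancel-≤ (ℚᵘ.≤-respʳ-≃ (ℚᵘ.≃-sym (toℚᵘ-homo-* (fromℕℚ (suc k)) ε))
      (ℚᵘ.*≤* (ℤ.+≤+ (lemma k d≤k))))))
  where
  lemma : ∀ k → d ℕ.≤ k → 1 ℕ.* (1 ℕ.* suc d) ℕ.≤ (suc k ℕ.* suc a) ℕ.* 1
  lemma k d≤k = begin
    1 ℕ.* (1 ℕ.* suc d)     ≡⟨ trans (ℕ.*-identityˡ _) (ℕ.*-identityˡ _) ⟩
    suc d                   ≤⟨ s≤s d≤k ⟩
    suc k                   ≤⟨ ℕ.m≤m*n (suc k) (suc a) ⟩
    suc k ℕ.* suc a         ≡⟨ ℕ.*-identityʳ _ ⟨
    (suc k ℕ.* suc a) ℕ.* 1 ∎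
    where open ℕ.≤-Reasoning
step-small {mkℚ (ℤ.+ 0)    _ _} (*<* (ℤ.+<+ ()))
step-small {mkℚ ℤ.-[1+ _ ] _ _} (*<* ())

search : ∀ k q m → q ≤ multiple k m →
         ∃ λ j → j ℕ.≤ m × q ≤ multiple k j × (multiple k j ≤ 0ℚ ⊎ multiple k j ≤ q + step k)
search k q zero    q≤ = 0 , z≤n , q≤ , inj₁ (≤-reflexive (multiple-0 k))
search k q (suc m) q≤ with ≤-total q (multiple k m)
... | inj₁ q≤′ = let j , j≤m , rest = search k q m q≤′ in j , ℕ.m≤n⇒m≤1+n j≤m , rest
... | inj₂ ≤q  = suc m , ℕ.≤-refl , q≤ , inj₂ (≤-trans
  (≤-reflexive (trans (multiple-suc k m) (+-comm (step k) (multiple k m))))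
  (+-monoˡ-≤ (step k) ≤q))

round : ∀ k → 0ℚ < ε → step k ≤ ε → ∀ {x} → 0ᴿ ≤ᴿ x → x ≤ᴿ 1ᴿ →
        ∃ λ j → x ≤ᴿ fromℚ (grid k j) × Eventually λ n → grid k j ≤ seq x n + (ε + ε)
round {ε} k 0<ε step≤ε {x} 0≤x x≤1 =
  let η , 0<η , η+η≡ε = halve 0<ε
      N , h = cauchy-≤ {seq x} (cauchy x) η 0<η
  in go (seq x N + η)
        (N , λ n N≤n → h n N N≤n ℕ.≤-refl)
        (N , λ n N≤n → ≤-trans (+-monoˡ-≤ η (h N n ℕ.≤-refl N≤n))
               (≤-reflexive (trans (+-assoc (seq x n) η η) (cong (seq x n +_) η+η≡ε))))
  where
  0≤ε = <⇒≤ 0<ε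

  widen : ∀ {p n} → p ≤ seq x n + ε → p ≤ seq x n + (ε + ε)
  widen {p} {n} h = ≤-trans h (+-monoʳ-≤ (seq x n) (≤-steps {ε} {ε} 0≤ε))

  go : ∀ q → Eventually (λ n → seq x n ≤ q) → Eventually (λ n → q ≤ seq x n + ε) →
       ∃ λ j → x ≤ᴿ fromℚ (grid k j) × Eventually λ n → grid k j ≤ seq x n + (ε + ε)
  go q x≤q q≤x with ≤-total 1ℚ q
  ... | inj₁ 1≤q = one k ,
    subst (λ g → x ≤ᴿ fromℚ g) (sym (grid-one k)) x≤1 ,
    ev-map (λ {n} h → widen {_} {n} (≤-trans (≤-reflexive (grid-one k)) (≤-trans 1≤q h))) q≤x
  ... | inj₂ q≤1 = found (search k q (suc k) (≤-trans q≤1 (≤-reflexive (sym (multiple-1 k)))))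
    where
    found : (∃ λ j → j ℕ.≤ suc k × q ≤ multiple k j ×
               (multiple k j ≤ 0ℚ ⊎ multiple k j ≤ q + step k)) →
            ∃ λ j → x ≤ᴿ fromℚ (grid k j) × Eventually λ n → grid k j ≤ seq x n + (ε + ε)
    found (j , j≤ , q≤j , j≤q) = i ,
      (λ { .within δ 0<δ → ev-map (λ {n} h → ≤-trans h (≤-trans q≤grid
             (≤-steps {δ} {grid k i} (<⇒≤ 0<δ)))) x≤q }) ,
      upper j≤q
      where
      i : Index k
      i = fromℕ< (s≤s j≤)
      grid≡ : grid k i ≡ multiple k j ⊓ 1ℚ
      grid≡ = cong (λ a → multiple k a ⊓ 1ℚ) (toℕ-fromℕ< (s≤s j≤))
      q≤grid : q ≤ grid k i
      q≤grid = ≤-trans (⊓-glb q≤j q≤1) (≤-reflexive (sym grid≡))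
      grid≤ : grid k i ≤ multiple k j
      grid≤ = ≤-trans (≤-reflexive grid≡) (p⊓q≤p (multiple k j) 1ℚ)
      upper : multiple k j ≤ 0ℚ ⊎ multiple k j ≤ q + step k →
              Eventually λ n → grid k i ≤ seq x n + (ε + ε)
      upper (inj₁ h) = ev-map (λ {n} 0≤ → widen {_} {n} (≤-trans grid≤ (≤-trans h 0≤)))
                              (within 0≤x ε 0<ε)
      upper (inj₂ h) = ev-map (λ {n} q≤ → ≤-trans grid≤ (≤-trans h
        (≤-trans (+-mono-≤ {q} {seq x n + ε} {step k} {ε} q≤ step≤ε)
                 (≤-reflexive (+-assoc (seq x n) ε ε))))) q≤x

∑-approx : ∀ n → 0ℚ < ε → ∃ λ δ → 0ℚ < δ × (∀ (s t : Fin n → ℝ) →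
           (∀ i → Eventually λ m → seq (s i) m ≤ seq (t i) m + δ) →
           Eventually λ m → seq (∑ s) m ≤ seq (∑ t) m + ε)
∑-approx {ε} zero 0<ε = ε , 0<ε , λ s t h → always λ m → ≤-steps {ε} {0ℚ} (<⇒≤ 0<ε)
∑-approx {ε} (suc n) 0<ε =
  let η , 0<η , η+η≡ε = halve 0<ε
      δ , 0<δ , f = ∑-approx n 0<η
  in δ ⊓ η , ⊓-pos 0<δ 0<η , λ s t h →
     ev-zip (λ {m} → +-approx {seq (s zero) m} {seq (t zero) m}
                              {seq (∑ (s ∘ suc)) m} {seq (∑ (t ∘ suc)) m} η+η≡ε)
       (ev-map (λ {m} a → ≤-trans a (+-monoʳ-≤ (seq (t zero) m) (p⊓q≤q δ η))) (h zero))
       (f (s ∘ suc) (t ∘ suc) λ i →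
         ev-map (λ {m} a → ≤-trans a (+-monoʳ-≤ (seq (t (suc i)) m) (p⊓q≤p δ η))) (h (suc i)))

max-approx : ∀ {n ε} (s t : Input n → ℝ) →
             (∀ x → Eventually λ m → seq (s x) m ≤ seq (t x) m + ε) →
             Eventually λ m → seq (maxInput _⊔ᴿ_ s) m ≤ seq (maxInput _⊔ᴿ_ t) m + ε
max-approx {zero}      s t h = h []
max-approx {suc n} {ε} s t h = ev-zip (λ {m} → ⊔-approx
    {seq (maxInput _⊔ᴿ_ s₀) m} {seq (maxInput _⊔ᴿ_ t₀) m}
    {seq (maxInput _⊔ᴿ_ s₁) m} {seq (maxInput _⊔ᴿ_ t₁) m} {ε})
  (max-approx s₀ t₀ (λ x → h (false ∷ x)))
  (max-approx s₁ t₁ (λ x → h (true ∷ x)))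
  where
  s₀ s₁ t₀ t₁ : Input n → ℝ
  s₀ x = s (false ∷ x)
  s₁ x = s (true ∷ x)
  t₀ x = t (false ∷ x)
  t₁ x = t (true ∷ x)

-- Without function extensionality these lists are complete only up to
-- pointwise equality.

module _ {A B : Set} (R : A → B → Set) where

  finFunctions : List B → ∀ n → List (Fin n → B)
  finFunctions bs zero    = (λ ()) ∷ []
  finFunctions bs (suc n) = cartesianProductWith
    (λ b g → λ { zero → b ; (suc i) → g i }) bs (finFunctions bs n)

  finFunctions-complete : ∀ {bs} → (∀ a → Any (R a) bs) → ∀ n (g : Fin n → A) →
    Any (λ h → ∀ i → R (g i) (h i)) (finFunctions bs n)
  finFunctions-complete c zero    g = here λ ()
  finFunctions-complete c (suc n) g = cartesianProductWith⁺ _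
    (λ { p q zero → p ; p q (suc i) → q i })
    (c (g zero)) (finFunctions-complete c n (g ∘ suc))

  inputFunctions : List B → ∀ n → List (Input n → B)
  inputFunctions bs zero    = List.map (λ b _ → b) bs
  inputFunctions bs (suc n) = cartesianProductWith
    (λ g h → λ { (false ∷ x) → g x ; (true ∷ x) → h x })
    (inputFunctions bs n) (inputFunctions bs n)

  inputFunctions-complete : ∀ {bs} → (∀ a → Any (R a) bs) → ∀ n (g : Input n → A) →
    Any (λ h → ∀ x → R (g x) (h x)) (inputFunctions bs n)
  inputFunctions-complete c zero    g = map⁺ (Any.map (λ { r [] → r }) (c (g [])))
  inputFunctions-complete c (suc n) g = cartesianProductWith⁺ _
    (λ { p q (false ∷ x) → p x ; p q (true ∷ x) → q x })
    (inputFunctions-complete c n (λ x → g (false ∷ x)))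
    (inputFunctions-complete c n (λ x → g (true ∷ x)))

constant-sum-nonneg : ∀ c → 1ℚ ≤ c * c → ∀ {n} (x y : Input n) m →
                      0ℚ ≤ seq (∑ (sepTerm (λ _ _ → fromℚ c) x y)) m
constant-sum-nonneg c 1≤c² []      []      m = ≤-refl
constant-sum-nonneg c 1≤c² (a ∷ x) (b ∷ y) m = extend (does (a Bool.≟ b))
  where
  rest = ∑ (sepTerm (λ _ _ → fromℚ c) x y)
  extend : ∀ d → 0ℚ ≤ seq ((if d then 0ᴿ else fromℚ c *ᴿ fromℚ c) +ᴿ rest) m
  extend true  = +-mono-≤ {0ℚ} {0ℚ} {0ℚ} {seq rest m} ≤-refl
                   (constant-sum-nonneg c 1≤c² x y m)
  extend false = +-mono-≤ {0ℚ} {c * c} {0ℚ} {seq rest m} (≤-trans 0≤1 1≤c²)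
                   (constant-sum-nonneg c 1≤c² x y m)

constant-separates : ∀ c → 1ℚ ≤ c * c → ∀ {n} (x y : Input n) → x ≢ y → ∀ m →
                     1ℚ ≤ seq (∑ (sepTerm (λ _ _ → fromℚ c) x y)) m
constant-separates c 1≤c² []      []      x≢y m = ⊥-elim (x≢y refl)
constant-separates c 1≤c² (a ∷ x) (b ∷ y) x≢y m = extend (a Bool.≟ b)
  where
  rest = ∑ (sepTerm (λ _ _ → fromℚ c) x y)
  extend : (d : Dec (a ≡ b)) →
           1ℚ ≤ seq ((if does d then 0ᴿ else fromℚ c *ᴿ fromℚ c) +ᴿ rest) m
  extend (yes refl) = ≤-trans (constant-separates c 1≤c² x y (x≢y ∘ cong (a ∷_)) m)
                              (≤-reflexive (sym (+-identityˡ (seq rest m))))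
  extend (no _)     = +-mono-≤ {1ℚ} {c * c} {0ℚ} {seq rest m} 1≤c²
                        (constant-sum-nonneg c 1≤c² x y m)

module ℚExtrema = Data.List.Extrema (DecTotalOrder.totalOrder ≤-decTotalOrder)

module Approximation {n} (f : BoolFun n) where

  Table : ℕ → Set
  Table k = Input n → Fin n → Index k

  weights : ∀ {k} → Table k → Weights n
  weights {k} g x i = fromℚ (grid k (g x i))

  value : ∀ {k} → Table k → ℚ
  value g = seq (objective (weights g)) 0

  weights-constant : ∀ {k} (g : Table k) x i → Constant (weights g x i)
  weights-constant g x i n = refl

  objective-constant : ∀ {k} (g : Table k) m → seq (objective (weights g)) m ≡ value g
  objective-constant g = max-constant λ x → ∑-constant {t = weights g x} (weights-constant g x)

  Separates : Weights n → Set
  Separates w = ∀ x y → f x ≢ f y → 1ᴿ ≤ᴿ ∑ (sepTerm w x y)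

  separates? : ∀ {k} (g : Table k) → Dec (Separates (weights g))
  separates? g = allInput? λ x → allInput? λ y → ¬? (f x Bool.≟ f y) →-dec
    constant-≤? (∑-constant {t = sepTerm (weights g) x y}
                            (sepTerm-constant (weights g) (weights-constant g) x y))

  feasible : ∀ {k} (g : Table k) → Separates (weights g) → Feasible f (weights g)
  feasible     g sep .separates     = sep
  feasible {k} g sep .nonneg    x i = pointwise-≤ λ _ → 0≤grid k (g x i)
  feasible {k} g sep .atMostOne x i = pointwise-≤ λ _ → grid≤1 k (g x i)

  tables : ∀ k → List (Table k)
  tables k = inputFunctions (λ (g h : Fin n → Index k) → ∀ i → g i ≡ h i)
    (finFunctions {Index k} _≡_ (allFin (suc (suc k))) n) n

  tables-complete : ∀ k (g : Table k) → Any (λ h → ∀ x i → g x i ≡ h x i) (tables k)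
  tables-complete k = inputFunctions-complete (λ g h → ∀ i → g i ≡ h i)
    (finFunctions-complete _≡_ ∈-allFin n) n

  ones : ∀ k → Table k
  ones k x i = one k

  ones-separates : ∀ k → Separates (weights (ones k))
  ones-separates k x y fx≢fy = pointwise-≤ (constant-separates
    (grid k (one k)) (≤-reflexive (sym (cong₂ _*_ (grid-one k) (grid-one k))))
    x y (fx≢fy ∘ cong f))

  candidates : ∀ k → List (Table k)
  candidates k = filter separates? (tables k)

  best : ∀ k → Table k
  best k = ℚExtrema.argmin value (ones k) (candidates k)

  best-feasible : ∀ k → Feasible f (weights (best k))
  best-feasible k = feasible (best k)
    (ℚExtrema.argmin-all value {P = λ g → Separates (weights g)}
      (ones-separates k) (all-filter separates? (tables k)))

  best-minimal : ∀ k (g : Table k) → g ∈ tables k → Separates (weights g) →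
                 value (best k) ≤ value g
  best-minimal k g g∈ sep = All.lookup
    (ℚExtrema.f[argmin]≤f[xs] {f = value} (ones k) (candidates k))
    (∈-filter⁺ separates? g∈ sep)

  rounded-separates : ∀ {k} (g : Table k) {w} → Feasible f w →
    (∀ x i → w x i ≤ᴿ weights g x i) → Separates (weights g)
  rounded-separates {k} g {w} feas w≤g x y fx≢fy =
    ≤ᴿ-trans (separates feas x y fx≢fy) (∑-mono term)
    where
    term : ∀ i → sepTerm w x y i ≤ᴿ sepTerm (weights g) x y i
    term i with does (lookup x i Bool.≟ lookup y i)
    ... | true  = ≤ᴿ-refl
    ... | false = *ᴿ-mono-fromℚ (nonneg feas x i) (nonneg feas y i) (w≤g x i) (w≤g y i)
      (0≤grid k (g x i)) (grid≤1 k (g x i)) (0≤grid k (g y i)) (grid≤1 k (g y i))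

  record Rounding k (ε : ℚ) (w : Weights n) : Set where
    field
      table  : Table k
      listed : table ∈ tables k
      lower  : ∀ x i → w x i ≤ᴿ weights table x i
      upper  : ∀ x i → Eventually λ m → seq (weights table x i) m ≤ seq (w x i) m + ε

  roundWeights : ∀ k → 0ℚ < ε → step k ≤ ε → ∀ {w} → Feasible f w → Rounding k (ε + ε) w
  roundWeights {ε} k 0<ε step≤ε {w} feas = choose (find (tables-complete k table₀))
    where
    rounded : ∀ x i → ∃ λ j → w x i ≤ᴿ fromℚ (grid k j) ×
                              Eventually λ m → grid k j ≤ seq (w x i) m + (ε + ε)
    rounded x i = round {ε} k 0<ε step≤ε {w x i} (nonneg feas x i) (atMostOne feas x i)
    table₀ : Table k
    table₀ x i = proj₁ (rounded x i)
    choose : (∃ λ g → g ∈ tables k × (∀ x i → table₀ x i ≡ g x i)) → Rounding k (ε + ε) w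
    choose (g , g∈ , same) = record
      { table  = g
      ; listed = g∈
      ; lower  = λ x i → subst (λ j → w x i ≤ᴿ fromℚ (grid k j)) (same x i)
                               (proj₁ (proj₂ (rounded x i)))
      ; upper  = λ x i → subst (λ j → Eventually λ m → grid k j ≤ seq (w x i) m + (ε + ε))
                               (same x i) (proj₂ (proj₂ (rounded x i)))
      }

  best-below : ∀ {k δ w} → Feasible f w → Rounding k δ w →
    (∀ (s t : Fin n → ℝ) → (∀ i → Eventually λ m → seq (s i) m ≤ seq (t i) m + δ) →
                           Eventually λ m → seq (∑ s) m ≤ seq (∑ t) m + ε) →
    Eventually λ m → value (best k) ≤ seq (objective w) m + ε
  best-below {ε} {k} {δ} {w} feas r approx = ev-map
    (λ {m} → ≤-trans {value (best k)} (≤-trans {value (best k)}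
      (best-minimal k table listed (rounded-separates table feas lower))
      (≤-reflexive (sym (objective-constant table m)))))
    (max-approx {n} {ε} (λ x → ∑ (weights table x)) (λ x → ∑ (w x))
                (λ x → approx (weights table x) (w x) (upper x)))
    where open Rounding r

  best-approx : 0ℚ < ε → ∃ λ N → ∀ k → N ℕ.≤ k → ∀ w → Feasible f w →
                Eventually λ m → value (best k) ≤ seq (objective w) m + ε
  best-approx {ε} 0<ε =
    let δ , 0<δ , approx = ∑-approx {ε} n 0<ε
        η , 0<η , η+η≡δ = halve {δ} 0<δ
        N , small = step-small {η} 0<η
    in N , λ k N≤k w feas → best-below {ε} {k} {δ} {w} feas
         (subst (λ d → Rounding k d w) η+η≡δ (roundWeights {η} k 0<η (small k N≤k) feas))
         approx

  best-cauchy : ∀ ε → 0ℚ < ε → ∃ λ N → ∀ j k → N ℕ.≤ j → N ℕ.≤ k →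
                value (best j) ≤ value (best k) + ε
  best-cauchy ε 0<ε =
    let N , h = best-approx 0<ε
    in N , λ j k N≤j N≤k → ev-const (ev-map
         (λ {m} → subst (λ v → value (best j) ≤ v + ε) (objective-constant (best k) m))
         (h j N≤j (weights (best k)) (best-feasible k)))

  limit : ℝ
  limit = mkℝ (λ k → value (best k)) (≤-cauchy best-cauchy)

  limit-optimal : IsOptimalValue f limit
  limit-optimal .lowerBound w feas .within ε 0<ε =
    let η , 0<η , η+η≡ε = halve 0<ε
        M , near = best-cauchy η 0<η
        N , below = best-approx 0<η
        K = M ℕ.⊔ N
        K′ , h = below K (ℕ.m≤n⊔m M N) w feas
    in K ℕ.⊔ K′ , λ m le → begin
      value (best m)
        ≤⟨ near m K (ℕ.≤-trans (ℕ.m≤m⊔n M N) (ℕ.≤-trans (ℕ.m≤m⊔n K K′) le)) (ℕ.m≤m⊔n M N) ⟩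
      value (best K) + η
        ≤⟨ +-monoˡ-≤ η (h m (ℕ.≤-trans (ℕ.m≤n⊔m K K′) le)) ⟩
      seq (objective w) m + η + η
        ≡⟨ trans (+-assoc (seq (objective w) m) η η) (cong (seq (objective w) m +_) η+η≡ε) ⟩
      seq (objective w) m + ε ∎
    where open ≤-Reasoning
  limit-optimal .approached ε 0<ε =
    let N , near = best-cauchy ε 0<ε
    in weights (best N) , best-feasible N , λ { .within δ 0<δ → N , λ m N≤m →
         ≤-trans (≤-reflexive (objective-constant (best N) m))
           (≤-trans (near N m ℕ.≤-refl N≤m)
                    (≤-steps {δ} {value (best m) + ε} (<⇒≤ 0<δ))) }

abstract
  optimum : ∀ {n} (f : BoolFun n) → ∃ (IsOptimalValue f)
  optimum f = Approximation.limit f , Approximation.limit-optimal f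

EC : ∀ {n} → BoolFun n → ℝ
EC f = proj₁ (optimum f)

EC-optimal : ∀ {n} (f : BoolFun n) → IsOptimalValue f (EC f)
EC-optimal f = proj₂ (optimum f)

{-# OPTIONS --safe #-}

-- Write s for the largest number of sensitive coordinates of any input, and
-- greedily collect k disjoint minimal sensitive blocks of x until their union
-- certifies f x.  Minimality makes every i in a block B sensitive for x ⊕ B, so
-- C(f,x) ≤ k s.  Since weights are at most 1, the constraint between x and
-- x ⊕ B forces w_x(B) ≥ 1.  Summing this over the k blocks gives k ≤ EC(f);
-- applying it to the singleton blocks of an input gives s ≤ EC(f).
module Submission where

import Data.Bool.Properties as Bool
open import Data.Bool.Base using (Bool; true; false; _xor_; if_then_else_)
open import Data.Fin.Base using (Fin; zero; suc)
open import Data.Fin.Properties using (all?; any?)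
open import Data.Fin.Subset
  using (Subset; inside; outside; ⊥; ⁅_⁆; _∈_; _∉_; _⊆_; _⊂_; _⊃_; _∪_; _-_; ∣_∣)
open import Data.Fin.Subset.Induction using (Acc; acc; ⊂-wellFounded; ⊃-wellFounded)
open import Data.Fin.Subset.Properties
  using (_∈?_; anySubset?; ∣⊥∣≡0; ∉⊥; nonempty?; Empty-unique; p⊆p∪q; q⊆p∪q; p─⊥≡p; p─q⊆p;
         x∈p⇒p-x⊂p; p⊆q⇒∣p∣≤∣q∣)
open import Data.Maybe.Base using (just; nothing)
open import Data.Nat using (ℕ; _≤_)
open import Data.Nat.Base as ℕ using (zero; suc; z≤n; s≤s)
import Data.Nat.Properties as ℕ
open import Data.Product using (∃; _×_; _,_; proj₁; proj₂)
open import Data.Rational.Base as ℚ using (ℚ; 0ℚ; 1ℚ; nonNegative)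
import Data.Rational.Properties as ℚ
open import Data.Rational.Solver using (module +-*-Solver)
open import Data.Sum.Base using (inj₁; inj₂)
open import Data.Vec.Base using ([]; _∷_; zipWith; lookup; tabulate; here; there)
open import Data.Vec.Properties
  using (lookup-zipWith; zipWith-identityʳ; lookup∘tabulate; lookup⇒[]=; []=⇒lookup)
open import Function.Base using (_∘_; id)
open import Relation.Binary.PropositionalEquality
  using (_≡_; _≢_; refl; sym; trans; cong; cong₂; ≢-sym)
open import Relation.Nullary.Decidable
  using (Dec; yes; no; does; dec-true; ¬?; _×-dec_; _→-dec_; map′; decidable-stable)
open import Relation.Nullary.Negation using (¬_; contradiction)
open import Defs

private
  variable
    n : ℕ

-- Reals

0≤fromℕℚ : ∀ k → 0ℚ ℚ.≤ fromℕℚ k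
0≤fromℕℚ k = ℚ.nonNegative⁻¹ (fromℕℚ k)

fromℕℚ-+ : ∀ m k → fromℕℚ (m ℕ.+ k) ≡ fromℕℚ m ℚ.+ fromℕℚ k
fromℕℚ-+ zero    k = sym (ℚ.+-identityˡ (fromℕℚ k))
fromℕℚ-+ (suc m) k = trans (fromℕℚ-suc (m ℕ.+ k))
  (trans (cong (1ℚ ℚ.+_) (fromℕℚ-+ m k))
  (trans (sym (ℚ.+-assoc 1ℚ (fromℕℚ m) (fromℕℚ k)))
         (cong (ℚ._+ fromℕℚ k) (sym (fromℕℚ-suc m)))))

fromℕℚ-* : ∀ m k → fromℕℚ (m ℕ.* k) ≡ fromℕℚ m ℚ.* fromℕℚ k
fromℕℚ-* zero    k = sym (ℚ.*-zeroˡ (fromℕℚ k))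
fromℕℚ-* (suc m) k = trans (fromℕℚ-+ k (m ℕ.* k))
  (trans (cong₂ ℚ._+_ (sym (ℚ.*-identityˡ (fromℕℚ k))) (fromℕℚ-* m k))
  (trans (sym (ℚ.*-distribʳ-+ (fromℕℚ k) 1ℚ (fromℕℚ m)))
         (cong (ℚ._* fromℕℚ k) (sym (fromℕℚ-suc m)))))

fromℕᴿ-mono : ∀ {m k} → m ≤ k → fromℕᴿ m ≤ᴿ fromℕᴿ k
fromℕᴿ-mono {k = k} z≤n = pointwise-≤ λ _ → 0≤fromℕℚ k
fromℕᴿ-mono (s≤s {m} {k} m≤k) .within ε 0<ε = always λ _ → begin
  fromℕℚ (suc m)           ≡⟨ fromℕℚ-suc m ⟩
  -- Both sequences are constant, so `ev-const` reads a rational inequality off the recursive call.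
  1ℚ ℚ.+ fromℕℚ m          ≤⟨ ℚ.+-monoʳ-≤ 1ℚ (ev-const (within (fromℕᴿ-mono m≤k) ε 0<ε)) ⟩
  1ℚ ℚ.+ (fromℕℚ k ℚ.+ ε)  ≡⟨ ℚ.+-assoc 1ℚ (fromℕℚ k) ε ⟨
  1ℚ ℚ.+ fromℕℚ k ℚ.+ ε    ≡⟨ cong (ℚ._+ ε) (fromℕℚ-suc k) ⟨
  fromℕℚ (suc k) ℚ.+ ε     ∎
  where open ℚ.≤-Reasoning

fromℕᴿ-suc : ∀ {k} → fromℕᴿ (suc k) ≤ᴿ 1ᴿ +ᴿ fromℕᴿ k
fromℕᴿ-suc {k} = pointwise-≤ λ _ → ℚ.≤-reflexive (fromℕℚ-suc k)

fromℕᴿ-* : ∀ m k → fromℕᴿ (m ℕ.* k) ≤ᴿ fromℕᴿ m *ᴿ fromℕᴿ k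
fromℕᴿ-* m k = pointwise-≤ λ _ → ℚ.≤-reflexive (fromℕℚ-* m k)

+ᴿ-identityˡ-≤ : ∀ {x} → x ≤ᴿ 0ᴿ +ᴿ x
+ᴿ-identityˡ-≤ {x} = pointwise-≤ λ m → ℚ.≤-reflexive (sym (ℚ.+-identityˡ (seq x m)))

*ᴿ-identityʳ-≤ : ∀ {x} → x *ᴿ 1ᴿ ≤ᴿ x
*ᴿ-identityʳ-≤ {x} = pointwise-≤ λ m → ℚ.≤-reflexive (ℚ.*-identityʳ (seq x m))

-- Expanding `(c + η) * (d + η)` leaves the error `η * (c + d + η)`, and `A`, `B` and 1 bound the
-- three summands. The hypotheses bound absolute values because terms approximating a nonnegative
-- real may be negative.
*-approx : ∀ {a b c d A B η ε} → 0ℚ ℚ.≤ η → η ℚ.≤ 1ℚ → η ℚ.* (A ℚ.+ B ℚ.+ 1ℚ) ℚ.≤ ε →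
           ℚ.∣ a ∣ ℚ.≤ c ℚ.+ η → ℚ.∣ b ∣ ℚ.≤ d ℚ.+ η → ℚ.∣ c ∣ ℚ.≤ A → ℚ.∣ d ∣ ℚ.≤ B →
           a ℚ.* b ℚ.≤ c ℚ.* d ℚ.+ ε
*-approx {a} {b} {c} {d} {A} {B} {η} {ε} 0≤η η≤1 ηQ≤ε a≤ b≤ c≤ d≤ = begin
  a ℚ.* b                  ≤⟨ p≤∣p∣ (a ℚ.* b) ⟩
  ℚ.∣ a ℚ.* b ∣            ≡⟨ ℚ.∣p*q∣≡∣p∣*∣q∣ a b ⟩
  ℚ.∣ a ∣ ℚ.* ℚ.∣ b ∣      ≤⟨ *-mono-≤ {ℚ.∣ a ∣} {c ℚ.+ η} (ℚ.0≤∣p∣ a) a≤ (ℚ.0≤∣p∣ b) b≤ ⟩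
  (c ℚ.+ η) ℚ.* (d ℚ.+ η)  ≡⟨ solve 3 (λ c d η → (c :+ η) :* (d :+ η) :=
                                         c :* d :+ η :* (c :+ d :+ η)) refl c d η ⟩
  c ℚ.* d ℚ.+ η ℚ.* (c ℚ.+ d ℚ.+ η)
    ≤⟨ ℚ.+-monoʳ-≤ (c ℚ.* d) (ℚ.*-monoˡ-≤-nonNeg η {{nonNegative 0≤η}}
         (ℚ.+-mono-≤ {c ℚ.+ d} {A ℚ.+ B} {η} {1ℚ}
           (ℚ.+-mono-≤ {c} {A} {d} {B} (ℚ.≤-trans (p≤∣p∣ c) c≤) (ℚ.≤-trans (p≤∣p∣ d) d≤)) η≤1)) ⟩
  c ℚ.* d ℚ.+ η ℚ.* (A ℚ.+ B ℚ.+ 1ℚ)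
    ≤⟨ ℚ.+-monoʳ-≤ (c ℚ.* d) ηQ≤ε ⟩
  c ℚ.* d ℚ.+ ε            ∎
  where
  open ℚ.≤-Reasoning
  open +-*-Solver using (solve; _:+_; _:*_; _:=_)

-- The second `δ` pays for the negative side: `- p` is at most `δ`, while `q` may itself fall `δ`
-- below zero.
∣p∣≤q+2δ : ∀ {p q δ} → 0ℚ ℚ.≤ δ → 0ℚ ℚ.≤ p ℚ.+ δ → 0ℚ ℚ.≤ q ℚ.+ δ → p ℚ.≤ q ℚ.+ δ →
           ℚ.∣ p ∣ ℚ.≤ q ℚ.+ (δ ℚ.+ δ)
∣p∣≤q+2δ {p} {q} {δ} 0≤δ 0≤p+δ 0≤q+δ p≤q+δ = ∣p∣≤ {p}
  (ℚ.≤-trans p≤q+δ (ℚ.+-monoʳ-≤ q (≤-steps {δ} {δ} 0≤δ)))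
  (begin
    ℚ.- p              ≡⟨ ℚ.+-identityˡ (ℚ.- p) ⟨
    0ℚ ℚ.- p           ≤⟨ ≤+⇒-≤ {0ℚ} {p} {δ} 0≤p+δ ⟩
    δ                  ≡⟨ ℚ.+-identityˡ δ ⟨
    0ℚ ℚ.+ δ           ≤⟨ ℚ.+-monoˡ-≤ δ 0≤q+δ ⟩
    q ℚ.+ δ ℚ.+ δ      ≡⟨ ℚ.+-assoc q δ δ ⟩
    q ℚ.+ (δ ℚ.+ δ)    ∎)
  where open ℚ.≤-Reasoning

*ᴿ-mono : ∀ {x x′ y y′} → 0ᴿ ≤ᴿ x → x ≤ᴿ x′ → 0ᴿ ≤ᴿ y → y ≤ᴿ y′ → x *ᴿ y ≤ᴿ x′ *ᴿ y′
*ᴿ-mono {x} {x′} {y} {y′} 0≤x x≤x′ 0≤y y≤y′ .within ε 0<ε =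
  let A , 0<A , evA = bounded {seq x′} (cauchy x′)
      B , 0<B , evB = bounded {seq y′} (cauchy y′)
      0<Q = ℚ.+-mono-< (ℚ.+-mono-< 0<A 0<B) 0<1
      η , 0<η , eq = divide 0<Q 0<ε
      -- The cap at 1 is the condition under which `*-approx` bounds its error by `θ * Q`.
      θ = η ℚ.⊓ 1ℚ
      0<θ = ⊓-pos 0<η 0<1
      -- Halved because `∣p∣≤q+2δ` doubles the tolerance.
      δ , 0<δ , δ+δ≡θ = halve 0<θ
      Q = A ℚ.+ B ℚ.+ 1ℚ
      θQ≤ε = ℚ.≤-trans (ℚ.*-monoʳ-≤-nonNeg Q {{nonNegative (ℚ.<⇒≤ 0<Q)}} (ℚ.p⊓q≤p η 1ℚ))
                       (ℚ.≤-reflexive eq)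
  in ev-zip (λ {m} (a≤ , c≤) (b≤ , d≤) →
         *-approx {seq x m} {seq y m} {seq x′ m} {seq y′ m}
           (ℚ.<⇒≤ 0<θ) (ℚ.p⊓q≤q η 1ℚ) θQ≤ε a≤ b≤ c≤ d≤)
       (ev-zip _,_ (abs≤ δ 0<δ θ δ+δ≡θ 0≤x x≤x′) evA)
       (ev-zip _,_ (abs≤ δ 0<δ θ δ+δ≡θ 0≤y y≤y′) evB)
  where
  abs≤ : ∀ δ → 0ℚ ℚ.< δ → ∀ θ → δ ℚ.+ δ ≡ θ → ∀ {z z′} → 0ᴿ ≤ᴿ z → z ≤ᴿ z′ →
         Eventually λ m → ℚ.∣ seq z m ∣ ℚ.≤ seq z′ m ℚ.+ θ
  abs≤ δ 0<δ _ refl {z} {z′} 0≤z z≤z′ =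
    ev-zip (λ {m} (a , b) c → ∣p∣≤q+2δ {seq z m} {seq z′ m} {δ} (ℚ.<⇒≤ 0<δ) a b c)
      (ev-zip _,_ (within 0≤z δ 0<δ) (within (≤ᴿ-trans 0≤z z≤z′) δ 0<δ))
      (within z≤z′ δ 0<δ)

-- Maxima over the cube and lower bounds on `EC`

module _ {A : Set} {_∙_ : A → A → A} where

  maxInput-elim : (P : A → Set) → (∀ {a b} → P a → P b → P (a ∙ b)) →
                  (g : Input n → A) → (∀ x → P (g x)) → P (maxInput _∙_ g)
  maxInput-elim {zero}  P P∙ g Pg = Pg []
  maxInput-elim {suc n} P P∙ g Pg = P∙
    (maxInput-elim P P∙ (λ x → g (false ∷ x)) (λ x → Pg (false ∷ x)))
    (maxInput-elim P P∙ (λ x → g (true ∷ x)) (λ x → Pg (true ∷ x)))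

  -- The relation is a parameter so that one induction serves both the real objective and the
  -- natural-number sensitivity.
  maxInput-upper : (_≼_ : A → A → Set) → (∀ {a} → a ≼ a) →
                   (∀ {a b c} → a ≼ b → b ≼ c → a ≼ c) →
                   (∀ a b → a ≼ (a ∙ b)) → (∀ a b → b ≼ (a ∙ b)) →
                   (g : Input n → A) → ∀ x → g x ≼ maxInput _∙_ g
  maxInput-upper _≼_ ≼-refl ≼-trans l r g []      = ≼-refl
  maxInput-upper _≼_ ≼-refl ≼-trans l r g (b ∷ x) with b
  ... | false = ≼-trans (maxInput-upper _≼_ ≼-refl ≼-trans l r (λ x → g (false ∷ x)) x) (l _ _)
  ... | true  = ≼-trans (maxInput-upper _≼_ ≼-refl ≼-trans l r (λ x → g (true ∷ x)) x) (r _ _)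

⊔-fromℕᴿ : ∀ {r} a b → fromℕᴿ a ≤ᴿ r → fromℕᴿ b ≤ᴿ r → fromℕᴿ (a ℕ.⊔ b) ≤ᴿ r
⊔-fromℕᴿ a b a≤ b≤ with ℕ.⊔-sel a b
... | inj₁ eq rewrite eq = a≤
... | inj₂ eq rewrite eq = b≤

∑≤objective : (w : Weights n) → ∀ x → ∑ (w x) ≤ᴿ objective w
∑≤objective w = maxInput-upper _≤ᴿ_ ≤ᴿ-refl ≤ᴿ-trans
  (λ x y → pointwise-≤ λ m → ℚ.p≤p⊔q (seq x m) (seq y m))
  (λ x y → pointwise-≤ λ m → ℚ.p≤q⊔p (seq x m) (seq y m))
  (λ x → ∑ (w x))

-- The infimum comes with feasible weights within every `δ` of it rather than with a minimiser; the
-- bound for such weights loses `δ`, which the slack in `_≤ᴿ_` absorbs.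
≤EC : ∀ {q} (f : BoolFun n) → (∀ w → Feasible f w → fromℚ q ≤ᴿ objective w) → fromℚ q ≤ᴿ EC f
≤EC {q = q} f h .within ε 0<ε =
  let δ , 0<δ , δ+δ≡ε = halve 0<ε
      w , feas , w≤EC = approached (EC-optimal f) δ 0<δ
  in ev-map (λ {m} q≤ → ℚ.≤-trans q≤ (ℚ.≤-reflexive
         (trans (ℚ.+-assoc (seq (EC f) m) δ δ) (cong (seq (EC f) m ℚ.+_) δ+δ≡ε))))
       (within (≤ᴿ-trans (h w feas) w≤EC) δ 0<δ)

-- Sums over subsets

-- Extension by zero keeps every partial sum indexed by `Fin n`, so it can be compared with
-- `sepTerm` sums term by term.
restrictTo : Subset n → (Fin n → ℝ) → Fin n → ℝ
restrictTo p v i = if lookup p i then v i else 0ᴿ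

∑[_] : Subset n → (Fin n → ℝ) → ℝ
∑[ p ] v = ∑ (restrictTo p v)

∑[]≤∑ : (p : Subset n) {v : Fin n → ℝ} → (∀ i → 0ᴿ ≤ᴿ v i) → ∑[ p ] v ≤ᴿ ∑ v
∑[]≤∑ p {v} 0≤v = ∑-mono term
  where
  term : ∀ i → restrictTo p v i ≤ᴿ v i
  term i with lookup p i
  ... | inside  = ≤ᴿ-refl
  ... | outside = 0≤v i

∑[⊥]≤0 : (v : Fin n → ℝ) → ∑[ ⊥ ] v ≤ᴿ 0ᴿ
∑[⊥]≤0 {zero}  v = ≤ᴿ-refl
∑[⊥]≤0 {suc n} v = ≤ᴿ-trans (+ᴿ-mono ≤ᴿ-refl (∑[⊥]≤0 (v ∘ suc))) (pointwise-≤ λ _ → ℚ.≤-refl)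

∑[⁅i⁆]≤ : (v : Fin n → ℝ) → ∀ i → ∑[ ⁅ i ⁆ ] v ≤ᴿ v i
∑[⁅i⁆]≤ v zero    = ≤ᴿ-trans (+ᴿ-mono ≤ᴿ-refl (∑[⊥]≤0 (v ∘ suc)))
  (pointwise-≤ λ m → ℚ.≤-reflexive (ℚ.+-identityʳ (seq (v zero) m)))
∑[⁅i⁆]≤ v (suc i) = ≤ᴿ-trans (+ᴿ-mono ≤ᴿ-refl (∑[⁅i⁆]≤ (v ∘ suc) i))
  (pointwise-≤ λ m → ℚ.≤-reflexive (ℚ.+-identityˡ (seq (v (suc i)) m)))

∣p∣≤∑[p] : (p : Subset n) {v : Fin n → ℝ} → (∀ {i} → i ∈ p → 1ᴿ ≤ᴿ v i) →
           fromℕᴿ ∣ p ∣ ≤ᴿ ∑[ p ] v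
∣p∣≤∑[p] []            1≤v = ≤ᴿ-refl
∣p∣≤∑[p] (inside  ∷ p) 1≤v =
  ≤ᴿ-trans (fromℕᴿ-suc {∣ p ∣}) (+ᴿ-mono (1≤v here) (∣p∣≤∑[p] p (1≤v ∘ there)))
∣p∣≤∑[p] (outside ∷ p) 1≤v =
  ≤ᴿ-trans +ᴿ-identityˡ-≤ (+ᴿ-mono ≤ᴿ-refl (∣p∣≤∑[p] p (1≤v ∘ there)))

Disjoint : Subset n → Subset n → Set
Disjoint p q = ∀ {i} → i ∈ p → i ∉ q

disjoint? : (p q : Subset n) → Dec (Disjoint p q)
disjoint? p q = map′ (λ h {i} → h i) (λ disj i → disj {i})
  (all? λ i → i ∈? p →-dec ¬? (i ∈? q))

disjoint-tail : ∀ {a b} {p q : Subset n} → Disjoint (a ∷ p) (b ∷ q) → Disjoint p q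
disjoint-tail disj i∈p i∈q = disj (there i∈p) (there i∈q)

-- Stated on the approximating rationals, where equality is available. The summand for `q` comes
-- first to match `1ᴿ +ᴿ fromℕᴿ k` when a new block `q` joins a cover `p`.
∑[p∪q] : (p q : Subset n) (v : Fin n → ℝ) → Disjoint p q →
         ∀ m → seq (∑[ q ] v) m ℚ.+ seq (∑[ p ] v) m ≡ seq (∑[ p ∪ q ] v) m
∑[p∪q] []      []      v disj m = refl
∑[p∪q] (a ∷ p) (b ∷ q) v disj m = trans
  (interchange (seq (restrictTo (b ∷ q) v zero) m) (seq (∑[ q ] (v ∘ suc)) m)
               (seq (restrictTo (a ∷ p) v zero) m) (seq (∑[ p ] (v ∘ suc)) m))
  (cong₂ ℚ._+_ (head a b disj) (∑[p∪q] p q (v ∘ suc) (disjoint-tail disj) m))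
  where
  interchange : ∀ a b c d → a ℚ.+ b ℚ.+ (c ℚ.+ d) ≡ a ℚ.+ c ℚ.+ (b ℚ.+ d)
  interchange = solve 4 (λ a b c d → a :+ b :+ (c :+ d) := a :+ c :+ (b :+ d)) refl
    where open +-*-Solver using (solve; _:+_; _:=_)
  head : ∀ a b → Disjoint (a ∷ p) (b ∷ q) →
         seq (restrictTo (b ∷ q) v zero) m ℚ.+ seq (restrictTo (a ∷ p) v zero) m ≡
         seq (restrictTo ((a ∷ p) ∪ (b ∷ q)) v zero) m
  head inside  inside  disj = contradiction here (disj here)
  head inside  outside disj = ℚ.+-identityˡ _
  head outside inside  disj = ℚ.+-identityʳ _
  head outside outside disj = refl

-- Subsets and inputs

∣p∪q∣≤∣p∣+∣q∣ : (p q : Subset n) → ∣ p ∪ q ∣ ≤ ∣ p ∣ ℕ.+ ∣ q ∣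
∣p∪q∣≤∣p∣+∣q∣ []            []            = z≤n
∣p∪q∣≤∣p∣+∣q∣ (inside  ∷ p) (inside  ∷ q) = s≤s (ℕ.≤-trans (∣p∪q∣≤∣p∣+∣q∣ p q)
                                                 (ℕ.+-monoʳ-≤ ∣ p ∣ (ℕ.n≤1+n ∣ q ∣)))
∣p∪q∣≤∣p∣+∣q∣ (inside  ∷ p) (outside ∷ q) = s≤s (∣p∪q∣≤∣p∣+∣q∣ p q)
∣p∪q∣≤∣p∣+∣q∣ (outside ∷ p) (inside  ∷ q) = ℕ.≤-trans (s≤s (∣p∪q∣≤∣p∣+∣q∣ p q))
                                                (ℕ.≤-reflexive (sym (ℕ.+-suc ∣ p ∣ ∣ q ∣)))
∣p∪q∣≤∣p∣+∣q∣ (outside ∷ p) (outside ∷ q) = ∣p∪q∣≤∣p∣+∣q∣ p q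

p⊂p∪q : ∀ {i} {p q : Subset n} → Disjoint p q → i ∈ q → p ⊂ p ∪ q
p⊂p∪q {i = i} {p} {q} disj i∈q = p⊆p∪q q , i , q⊆p∪q p q i∈q , λ i∈p → disj i∈p i∈q

module _ {P : Fin n → Set} (P? : ∀ i → Dec (P i)) where

  satisfying : Subset n
  satisfying = tabulate (does ∘ P?)

  ∈-satisfying⁺ : ∀ {i} → P i → i ∈ satisfying
  ∈-satisfying⁺ {i} Pi = lookup⇒[]= i satisfying
    (trans (lookup∘tabulate (does ∘ P?) i) (dec-true (P? i) Pi))

  ∈-satisfying⁻ : ∀ {i} → i ∈ satisfying → P i
  ∈-satisfying⁻ {i} i∈ with P? i | trans (sym (lookup∘tabulate (does ∘ P?) i)) ([]=⇒lookup i∈)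
  ... | yes Pi | _ = Pi

infixl 6 _⊕_

-- Inputs and subsets are both Boolean vectors. Hence `x ⊕ p` flips the coordinates in `p`, and for
-- an input `y`, `x ⊕ y` is also the set of coordinates where `x` and `y` differ.
_⊕_ : Input n → Subset n → Input n
_⊕_ = zipWith _xor_

⊕-⊥ : (x : Input n) → x ⊕ ⊥ ≡ x
⊕-⊥ = zipWith-identityʳ Bool.xor-identityʳ

⊕-⊕ : (x y : Input n) → x ⊕ (x ⊕ y) ≡ y
⊕-⊕ []      []      = refl
⊕-⊕ (a ∷ x) (b ∷ y) = cong₂ _∷_
  (trans (sym (Bool.xor-assoc a a b)) (cong (_xor b) (Bool.xor-same a))) (⊕-⊕ x y)

⊕-remove : (x : Input n) {p : Subset n} → ∀ {i} → i ∈ p → x ⊕ p ⊕ ⁅ i ⁆ ≡ x ⊕ (p - i)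
⊕-remove (a ∷ x) {_ ∷ p} here = cong₂ _∷_
  (Bool.xor-assoc a true true)
  (trans (⊕-⊥ (x ⊕ p)) (cong (x ⊕_) (sym (p─⊥≡p p))))
⊕-remove (a ∷ x) {b ∷ p} (there i∈p) = cong₂ _∷_ (Bool.xor-identityʳ (a xor b)) (⊕-remove x i∈p)

restrict : Input n → Subset n → Assignment n
restrict = zipWith λ a b → if b then just a else nothing

size-restrict : (x : Input n) (p : Subset n) → size (restrict x p) ≡ ∣ p ∣
size-restrict []      []            = refl
size-restrict (a ∷ x) (inside  ∷ p) = cong suc (size-restrict x p)
size-restrict (a ∷ x) (outside ∷ p) = size-restrict x p

∈-restrict : (x : Input n) (p : Subset n) → x ∈ᴬ restrict x p
∈-restrict (a ∷ x) (inside  ∷ p) zero    = inj₁ refl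
∈-restrict (a ∷ x) (outside ∷ p) zero    = inj₂ refl
∈-restrict (a ∷ x) (b ∷ p)       (suc i) = ∈-restrict x p i

-- Membership in the subcube forces `y` to agree with `x` on `p`. This turns an input that defeats
-- the certificate into a block avoiding `p`.
∈-restrict⇒disjoint : (x y : Input n) (p : Subset n) → y ∈ᴬ restrict x p → Disjoint p (x ⊕ y)
∈-restrict⇒disjoint (a ∷ x) (b ∷ y) (_ ∷ p) y∈ (there i∈p) (there i∈q) =
  ∈-restrict⇒disjoint x y p (y∈ ∘ suc) i∈p i∈q
∈-restrict⇒disjoint (a ∷ x) (b ∷ y) (inside ∷ p) y∈ {zero} here i∈q with y∈ zero
... | inj₁ refl = contradiction (trans (sym (Bool.xor-same a)) ([]=⇒lookup i∈q)) λ ()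

-- Sensitive blocks

module _ {n} (f : BoolFun n) where

  IsSensitiveBlock : Input n → Subset n → Set
  IsSensitiveBlock x p = f (x ⊕ p) ≢ f x

  isSensitiveBlock? : ∀ x p → Dec (IsSensitiveBlock x p)
  isSensitiveBlock? x p = ¬? (f (x ⊕ p) Bool.≟ f x)

  block-weight : ∀ {w} → Feasible f w → ∀ x p → IsSensitiveBlock x p → 1ᴿ ≤ᴿ ∑[ p ] (w x)
  block-weight {w} feas x p sens =
    ≤ᴿ-trans (separates feas x (x ⊕ p) (≢-sym sens)) (∑-mono term)
    where
    w≤ : ∀ y i → w x i *ᴿ w y i ≤ᴿ w x i
    w≤ y i = ≤ᴿ-trans
      (*ᴿ-mono (nonneg feas x i) ≤ᴿ-refl (nonneg feas y i) (atMostOne feas y i))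
      *ᴿ-identityʳ-≤
    term : ∀ i → sepTerm w x (x ⊕ p) i ≤ᴿ restrictTo p (w x) i
    -- After the rewrite, the test in `sepTerm` compares a bit with its `xor` with the bit of `p`,
    -- so fixing both bits decides both conditionals.
    term i rewrite lookup-zipWith _xor_ i x p with lookup x i | lookup p i
    ... | false | false = ≤ᴿ-refl
    ... | true  | false = ≤ᴿ-refl
    ... | false | true  = w≤ (x ⊕ p) i
    ... | true  | true  = w≤ (x ⊕ p) i

  sensitive : Input n → Subset n
  sensitive x = satisfying λ i → isSensitiveBlock? x ⁅ i ⁆

  sensitivity : ℕ
  sensitivity = maxInput ℕ._⊔_ (λ x → ∣ sensitive x ∣)

  ∣sensitive∣≤sensitivity : ∀ x → ∣ sensitive x ∣ ≤ sensitivity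
  ∣sensitive∣≤sensitivity =
    maxInput-upper _≤_ ℕ.≤-refl ℕ.≤-trans ℕ.m≤m⊔n ℕ.m≤n⊔m (λ x → ∣ sensitive x ∣)

  -- At one input, all sensitive coordinates have weight at least 1 under the same `w x`, so their
  -- number is at most its total.
  sensitivity≤EC : fromℕᴿ sensitivity ≤ᴿ EC f
  sensitivity≤EC = maxInput-elim (λ s → fromℕᴿ s ≤ᴿ EC f)
    (λ {a} {b} → ⊔-fromℕᴿ a b) (λ x → ∣ sensitive x ∣)
    λ x → ≤EC f λ w feas →
      ≤ᴿ-trans (∣p∣≤∑[p] (sensitive x) λ {i} i∈ → ≤ᴿ-trans
          (block-weight feas x ⁅ i ⁆ (∈-satisfying⁻ (λ i → isSensitiveBlock? x ⁅ i ⁆) i∈))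
          (∑[⁅i⁆]≤ (w x) i))
        (≤ᴿ-trans (∑[]≤∑ (sensitive x) (nonneg feas x)) (∑≤objective w x))

  -- Minimality is tested only against removal of one element: that is what `shrink` reaches and
  -- what `minimal-size` consumes.
  IsMinimalBlock : Input n → Subset n → Set
  IsMinimalBlock x p = IsSensitiveBlock x p × (∀ {i} → i ∈ p → ¬ IsSensitiveBlock x (p - i))

  shrink : ∀ x p → Acc _⊂_ p → IsSensitiveBlock x p → ∃ λ q → q ⊆ p × IsMinimalBlock x q
  shrink x p (acc rec) sens with any? (λ i → i ∈? p ×-dec isSensitiveBlock? x (p - i))
  ... | yes (i , i∈p , sens′) =
    let q , q⊆p-i , minimal = shrink x (p - i) (rec (x∈p⇒p-x⊂p i∈p)) sens′
    in q , p─q⊆p p ⁅ i ⁆ ∘ q⊆p-i , minimal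
  ... | no ∄i = p , id , sens , λ {i} i∈p sens′ → ∄i (i , i∈p , sens′)

  -- Flipping `i` in `x ⊕ p` gives `x ⊕ (p - i)`, where `f` is back to `f x`. So `p` consists of
  -- sensitive coordinates of `x ⊕ p`.
  minimal-size : ∀ x p → IsMinimalBlock x p → ∣ p ∣ ≤ sensitivity
  minimal-size x p (sens , minimal) = ℕ.≤-trans
    (p⊆q⇒∣p∣≤∣q∣ λ {i} i∈p → ∈-satisfying⁺ (λ i → isSensitiveBlock? (x ⊕ p) ⁅ i ⁆) λ same →
      -- Minimality is a double negation of `f (x ⊕ (p - i)) ≡ f x`; it applies directly because the
      -- goal is absurdity.
      minimal i∈p λ eq → sens (trans (sym same) (trans (cong f (⊕-remove x i∈p)) eq)))
    (∣sensitive∣≤sensitivity (x ⊕ p))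

  -- Ensures that a disjoint block strictly enlarges a cover, so that the greedy process terminates.
  sensitive-nonempty : ∀ x p → IsSensitiveBlock x p → ∃ (_∈ p)
  sensitive-nonempty x p sens with nonempty? p
  ... | yes i∈p   = i∈p
  ... | no  empty = contradiction
    (cong f (trans (cong (x ⊕_) (Empty-unique empty)) (⊕-⊥ x))) sens

  -- Greedy covers by disjoint minimal blocks

  record Covered (x : Input n) (p : Subset n) : Set where
    field
      -- Of the collected blocks only their number is kept. It is fixed before the weights are, so
      -- `≤∑` can be compared with the infimum.
      blocks : ℕ
      size≤  : ∣ p ∣ ≤ blocks ℕ.* sensitivity
      ≤∑     : ∀ {w} → Feasible f w → fromℕᴿ blocks ≤ᴿ ∑[ p ] (w x)

  open Covered

  covered-⊥ : ∀ x → Covered x ⊥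
  covered-⊥ x .blocks = 0
  covered-⊥ x .size≤  = ℕ.≤-reflexive (∣⊥∣≡0 n)
  covered-⊥ x .≤∑ _   =
    -- Nonnegativity of the empty sum is the counting bound at `⊥`, where the weight condition is
    -- vacuous.
    ≤ᴿ-trans (fromℕᴿ-mono (z≤n {∣ ⊥ {n} ∣})) (∣p∣≤∑[p] (⊥ {n}) λ i∈⊥ → contradiction i∈⊥ ∉⊥)

  covered-∪ : ∀ {x p q} → Covered x p → Disjoint p q → IsMinimalBlock x q → Covered x (p ∪ q)
  covered-∪ c _ _ .blocks = suc (blocks c)
  covered-∪ {x} {p} {q} c _ minimal .size≤ = begin
    ∣ p ∪ q ∣                                    ≤⟨ ∣p∪q∣≤∣p∣+∣q∣ p q ⟩
    ∣ p ∣ ℕ.+ ∣ q ∣                              ≤⟨ ℕ.+-mono-≤ (size≤ c) (minimal-size x q minimal) ⟩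
    blocks c ℕ.* sensitivity ℕ.+ sensitivity     ≡⟨ ℕ.+-comm _ sensitivity ⟩
    suc (blocks c) ℕ.* sensitivity               ∎
    where open ℕ.≤-Reasoning
  covered-∪ {x} {p} {q} c disj (sens , _) .≤∑ {w} feas = ≤ᴿ-trans (fromℕᴿ-suc {blocks c})
    (≤ᴿ-trans (+ᴿ-mono (block-weight feas x q sens) (≤∑ c feas))
              (pointwise-≤ λ m → ℚ.≤-reflexive (∑[p∪q] p q (w x) disj m)))

  -- Recursion is on the growth of `p`. When no sensitive block avoids `p`, any `y` in the subcube
  -- with `f y ≢ f x` would supply one, namely `x ⊕ y`; hence `p` certifies.
  cover : ∀ x p → Acc _⊃_ p → Covered x p →
          ∃ λ q → Covered x q × IsCertificate f (f x) (restrict x q)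
  cover x p (acc rec) c with anySubset? (λ q → disjoint? p q ×-dec isSensitiveBlock? x q)
  ... | no ∄q = p , c , λ y y∈ → decidable-stable (f y Bool.≟ f x) λ fy≢fx →
    ∄q (x ⊕ y , ∈-restrict⇒disjoint x y p y∈ , fy≢fx ∘ trans (sym (cong f (⊕-⊕ x y))))
  ... | yes (q , disj , sens) =
    -- Passing to a minimal subset keeps disjointness from `p` and makes the bound by `sensitivity`
    -- available.
    let r , r⊆q , minimal = shrink x q (⊂-wellFounded q) sens
        disj′ : Disjoint p r
        disj′ = λ i∈p → disj i∈p ∘ r⊆q
        _ , i∈r = sensitive-nonempty x r (proj₁ minimal)
    in cover x (p ∪ r) (rec (p⊂p∪q disj′ i∈r)) (covered-∪ c disj′ minimal)

  blocks≤EC : ∀ {x p} (c : Covered x p) → fromℕᴿ (blocks c) ≤ᴿ EC f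
  blocks≤EC {x} {p} c = ≤EC f λ w feas →
    ≤ᴿ-trans (≤∑ c feas) (≤ᴿ-trans (∑[]≤∑ p (nonneg feas x)) (∑≤objective w x))

  C[x]≤EC² : ∀ x → fromℕᴿ C[ f , x ] ≤ᴿ EC f *ᴿ EC f
  C[x]≤EC² x =
    let p , c , cert = cover x ⊥ (⊃-wellFounded ⊥) (covered-⊥ x)
        C≤ks = ℕ.≤-trans
          (smallestCertificate-minimal f x (restrict x p) (∈-restrict x p , cert))
          (ℕ.≤-trans (ℕ.≤-reflexive (size-restrict x p)) (size≤ c))
    in ≤ᴿ-trans (fromℕᴿ-mono C≤ks) (≤ᴿ-trans (fromℕᴿ-* (blocks c) sensitivity)
         -- The nonnegative factors are the two natural numbers, which `*ᴿ-mono` replaces by `EC f`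
         -- each.
         (*ᴿ-mono (fromℕᴿ-mono {0} z≤n) (blocks≤EC c) (fromℕᴿ-mono {0} z≤n) sensitivity≤EC))

mainTheorem8 : (n : ℕ) → 1 ≤ n → (f : BoolFun n) → fromℕᴿ (C f) ≤ᴿ EC f *ᴿ EC f
mainTheorem8 n _ f = maxInput-elim (λ c → fromℕᴿ c ≤ᴿ EC f *ᴿ EC f)
  (λ {a} {b} → ⊔-fromℕᴿ a b) (λ x → C[ f , x ]) (C[x]≤EC² f)
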